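{- Every R-Delaunay complex is a TD-Delaunay complex of $H_4\simeq\mathbb{R}^3$. That is, for every finite set $\mathcal{P}\subset\mathbb{R}^2$ in which no two distinct points share the same horizontal coordinate or the same vertical coordinate, the complex $\mathsf{RD}(\mathcal{P})$ is a TD-Delaunay complex of $H_4$.
   Context: **R-Delaunay complexes.** Let $\mathcal{P}$ be a finite set of points of $\mathbb{R}^2$ such that no two distinct points share the same vertical or horizontal coordinate. The R-Delaunay complex $\mathsf{RD}(\mathcal{P})$ is the abstract simplicial complex with vertex set $\mathcal{P}$ such that a subset $F\subseteq\mathcal{P}$ is a face if and only if there exists a (closed) axis-parallel rectangle $Q$ such that $Q\cap\mathcal{P}=F$ and $Q$ does not contain any point of $\mathcal{P}$ in its interior. **TD-Delaunay complexes.** For an integer $d$, $H_d=\{x\in\mathbb{R}^d : x_1+\cdots+x_d=1\}$. For $c\in\mathbb{R}^d$, the regular simplex $S_c$ is $\{u\in H_d : u_i\le c_i \text{ for all } i\in\{1,\dots,d\}\}$; it is positive if $\sum_{i=1}^d c_i\ge 1$; its interior is $\{u\in H_d : u_i<c_i \text{ for all } i\}$. A point set $\mathcal{P}\subset H_d$ is in general position if for any two distinct $x,y\in\mathcal{P}$, $x_i\ne y_i$ for every $i$. For a finite $\mathcal{P}\subset H_d$ in general position, $\mathsf{TDD}(\mathcal{P})$ is the simplicial complex with vertex set $\mathcal{P}$ in which $F\subseteq\mathcal{P}$ is a face if and only if there exists a positive regular simplex $S$ with $S\cap\mathcal{P}=F$ and with no point of $\mathcal{P}$ in the interior of $S$.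 An abstract simplicial complex is a TD-Delaunay complex of $H_d\simeq\mathbb{R}^{d-1}$ if it equals $\mathsf{TDD}(\mathcal{P})$, up to relabelling of vertices (isomorphism), for some finite $\mathcal{P}\subset H_d$ in general position. -}

module Defs where

open import Data.Bool.Base using (true; false)
open import Data.Empty using (⊥-elim)
open import Data.Fin.Base using (Fin; zero; suc)
import Data.Fin.Properties as Fin
open import Data.Fin.Subset using (Subset; _∈_; _∉_; _⊆_; ⁅_⁆; ⊤; Nonempty)
open import Data.Fin.Subset.Properties
  using (_∈?_; nonempty?; x∈⁅x⁆; x∈⁅y⁆⇒x≡y; ∈⊤)
open import Data.Nat.Base as ℕ using (ℕ; zero; suc)
import Data.Nat.Properties as ℕ
open import Data.Product.Base using (Σ-syntax; ∃-syntax; _×_; _,_; proj₁; proj₂)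
open import Data.Rational.Base as ℚ using (ℚ; 0ℚ; 1ℚ; ½)
import Data.Rational.Properties as ℚ
open import Data.Rational.Solver using (module +-*-Solver)
open import Data.Sum.Base using (_⊎_; inj₁; inj₂; [_,_]′)
open import Data.Vec.Base using ([]; _∷_; here; there; lookup; tabulate)
open import Data.Vec.Functional using (Vector; foldr)
open import Function.Base using (_∘_; id)
open import Function.Bundles using (_⇔_; _↔_; mk⇔; module Equivalence; module Inverse)
open import Relation.Binary.PropositionalEquality
  using (_≡_; _≢_; refl; sym; trans; cong; subst; subst₂)
open import Relation.Nullary using (¬_; Dec; yes; no)
open import Relation.Nullary.Decidable using (decidable-stable)

infix  4 _≈_ _<_ _≤_
infixl 6 _+_
infix  8 -_

-- Equality of real numbers is _≈_, not _≡_.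

IsCauchy : (ℕ → ℚ) → Set
IsCauchy s = ∀ ε → 0ℚ ℚ.< ε →
  ∃[ N ] (∀ m n → N ℕ.≤ m → N ℕ.≤ n → ℚ.∣ s m ℚ.- s n ∣ ℚ.< ε)

record ℝ : Set where
  constructor mkℝ
  field
    seq    : ℕ → ℚ
    cauchy : IsCauchy seq

open ℝ public

_≈_ : ℝ → ℝ → Set
x ≈ y = ∀ ε → 0ℚ ℚ.< ε →
  ∃[ N ] (∀ n → N ℕ.≤ n → ℚ.∣ seq x n ℚ.- seq y n ∣ ℚ.< ε)

_<_ : ℝ → ℝ → Set
x < y = ∃[ ε ] 0ℚ ℚ.< ε × ∃[ N ] (∀ n → N ℕ.≤ n → seq x n ℚ.+ ε ℚ.≤ seq y n)

_≤_ : ℝ → ℝ → Set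
x ≤ y = ¬ (y < x)

open +-*-Solver using (solve; con; _:+_; _:*_; :-_; _:-_; _:=_)

module ℚ-Lemmas where

  shift : ∀ {p q} a b → p ℚ.≤ q → b ℚ.- a ≡ q ℚ.- p → a ℚ.≤ b
  shift {p} {q} a b p≤q eq = subst₂ ℚ._≤_
    (solve 2 (λ a p → p :+ (a :- p) := a) refl a p)
    (trans (solve 3 (λ a p q → q :+ (a :- p) := a :+ (q :- p)) refl a p q)
      (trans (cong (a ℚ.+_) (sym eq)) (solve 2 (λ a b → a :+ (b :- a) := b) refl a b)))
    (ℚ.+-monoˡ-≤ (a ℚ.- p) p≤q)

  shift-< : ∀ {p q} a b → p ℚ.< q → b ℚ.- a ≡ q ℚ.- p → a ℚ.< b
  shift-< {p} {q} a b p<q eq = subst₂ ℚ._<_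
    (solve 2 (λ a p → p :+ (a :- p) := a) refl a p)
    (trans (solve 3 (λ a p q → q :+ (a :- p) := a :+ (q :- p)) refl a p q)
      (trans (cong (a ℚ.+_) (sym eq)) (solve 2 (λ a b → a :+ (b :- a) := b) refl a b)))
    (ℚ.+-monoˡ-< (a ℚ.- p) p<q)

  p≤∣p∣ : ∀ p → p ℚ.≤ ℚ.∣ p ∣
  p≤∣p∣ p with ℚ.≤-total 0ℚ p
  ... | inj₁ 0≤p = ℚ.≤-reflexive (sym (ℚ.0≤p⇒∣p∣≡p 0≤p))
  ... | inj₂ p≤0 = ℚ.≤-trans p≤0 (ℚ.0≤∣p∣ p)

  ∣p-q∣≡∣q-p∣ : ∀ p q → ℚ.∣ p ℚ.- q ∣ ≡ ℚ.∣ q ℚ.- p ∣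
  ∣p-q∣≡∣q-p∣ p q = trans (sym (ℚ.∣-p∣≡∣p∣ (p ℚ.- q)))
    (cong ℚ.∣_∣ (solve 2 (λ p q → :- (p :- q) := q :- p) refl p q))

  near⇒< : ∀ p q {ε} → ℚ.∣ p ℚ.- q ∣ ℚ.< ε → p ℚ.< q ℚ.+ ε
  near⇒< p q {ε} h = shift-< p (q ℚ.+ ε) (ℚ.≤-<-trans (p≤∣p∣ (p ℚ.- q)) h)
    (solve 3 (λ p q e → (q :+ e) :- p := e :- (p :- q)) refl p q ε)

  near⇒> : ∀ p q {ε} → ℚ.∣ p ℚ.- q ∣ ℚ.< ε → q ℚ.< p ℚ.+ ε
  near⇒> p q {ε} h = near⇒< q p (subst (ℚ._< ε) (∣p-q∣≡∣q-p∣ p q) h)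

  <⇒near : ∀ p q {ε} → p ℚ.< q ℚ.+ ε → q ℚ.< p ℚ.+ ε → ℚ.∣ p ℚ.- q ∣ ℚ.< ε
  <⇒near p q {ε} h k with ℚ.∣p∣≡p∨∣p∣≡-p (p ℚ.- q)
  ... | inj₁ eq = subst (ℚ._< ε) (sym eq) (shift-< (p ℚ.- q) ε h
    (solve 3 (λ p q e → e :- (p :- q) := (q :+ e) :- p) refl p q ε))
  ... | inj₂ eq = subst (ℚ._< ε) (sym eq) (shift-< (ℚ.- (p ℚ.- q)) ε k
    (solve 3 (λ p q e → e :- (:- (p :- q)) := (p :+ e) :- q) refl p q ε))

  half : ∀ ε → 0ℚ ℚ.< ε → 0ℚ ℚ.< ½ ℚ.* ε
  half ε 0<ε = subst (ℚ._< ½ ℚ.* ε) (ℚ.*-zeroʳ ½) (ℚ.*-monoʳ-<-pos ½ 0<ε)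

  half+half : ∀ ε → ½ ℚ.* ε ℚ.+ ½ ℚ.* ε ≡ ε
  half+half = solve 1 (λ e → con ½ :* e :+ con ½ :* e := e) refl

  ≤-⊔ˡ : ∀ {k} m n → m ℕ.⊔ n ℕ.≤ k → m ℕ.≤ k
  ≤-⊔ˡ m n = ℕ.≤-trans (ℕ.m≤m⊔n m n)

  ≤-⊔ʳ : ∀ {k} m n → m ℕ.⊔ n ℕ.≤ k → n ℕ.≤ k
  ≤-⊔ʳ m n = ℕ.≤-trans (ℕ.m≤n⊔m m n)

open ℚ-Lemmas

fromℚ : ℚ → ℝ
fromℚ q = mkℝ (λ _ → q) λ ε 0<ε → 0 , λ _ _ _ _ →
  subst (ℚ._< ε) (cong ℚ.∣_∣ (sym (ℚ.+-inverseʳ q))) 0<ε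

0ℝ 1ℝ : ℝ
0ℝ = fromℚ 0ℚ
1ℝ = fromℚ 1ℚ

_+_ : ℝ → ℝ → ℝ
x + y = mkℝ (λ n → seq x n ℚ.+ seq y n) λ ε 0<ε →
  let δ = ½ ℚ.* ε
      (M , p) = cauchy x δ (half ε 0<ε)
      (N , q) = cauchy y δ (half ε 0<ε)
  in M ℕ.⊔ N , λ m n M⊔N≤m M⊔N≤n →
    let a = seq x m
        b = seq y m
        c = seq x n
        d = seq y n
    in ℚ.≤-<-trans
      (subst (λ z → ℚ.∣ z ∣ ℚ.≤ ℚ.∣ a ℚ.- c ∣ ℚ.+ ℚ.∣ b ℚ.- d ∣)
        (solve 4 (λ a b c d → (a :- c) :+ (b :- d) := (a :+ b) :- (c :+ d)) refl a b c d)
        (ℚ.∣p+q∣≤∣p∣+∣q∣ (a ℚ.- c) (b ℚ.- d)))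
      (subst (ℚ.∣ a ℚ.- c ∣ ℚ.+ ℚ.∣ b ℚ.- d ∣ ℚ.<_) (half+half ε)
        (ℚ.+-mono-< (p m n (≤-⊔ˡ M N M⊔N≤m) (≤-⊔ˡ M N M⊔N≤n))
                    (q m n (≤-⊔ʳ M N M⊔N≤m) (≤-⊔ʳ M N M⊔N≤n))))

-_ : ℝ → ℝ
- x = mkℝ (λ n → ℚ.- seq x n) λ ε 0<ε →
  let (N , p) = cauchy x ε 0<ε
  in N , λ m n N≤m N≤n → subst (ℚ._< ε)
    (trans (sym (ℚ.∣-p∣≡∣p∣ (seq x m ℚ.- seq x n)))
      (cong ℚ.∣_∣ (solve 2 (λ a b → :- (a :- b) := (:- a) :- (:- b)) refl (seq x m) (seq x n))))
    (p m n N≤m N≤n)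

sum : ∀ {d} → Vector ℝ d → ℝ
sum = foldr _+_ 0ℝ

record SetSystem : Set₁ where
  field
    size : ℕ
    Face : Subset size → Set

record IsSimplicialComplex (K : SetSystem) : Set where
  open SetSystem K
  field
    vertex     : ∀ v → Face ⁅ v ⁆
    downClosed : ∀ {F G} → G ⊆ F → Face F → Face G

record SimplicialComplex : Set₁ where
  field
    system    : SetSystem
    isComplex : IsSimplicialComplex system
  open SetSystem system public
  open IsSimplicialComplex isComplex public

relabel : ∀ {m n} → Fin m ↔ Fin n → Subset m → Subset n
relabel σ F = tabulate (λ j → lookup F (Inverse.from σ j))

_≅_ : SetSystem → SetSystem → Set
K ≅ L = Σ[ σ ∈ (Fin K.size ↔ Fin L.size) ] (∀ F → K.Face F ⇔ L.Face (relabel σ F))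
  where
  module K = SetSystem K
  module L = SetSystem L

-- A finite set of points of ℝᵈ, enumerated without repetition; its subsets
-- are then the elements of Subset size.
record FinitePointSet (d : ℕ) : Set where
  field
    size     : ℕ
    point    : Fin size → Vector ℝ d
    distinct : ∀ {i j} → i ≢ j → ¬ (∀ k → point i k ≈ point j k)

GeneralPosition : ∀ {d} → FinitePointSet d → Set
GeneralPosition P = ∀ {i j} → i ≢ j → ∀ k → ¬ (point i k ≈ point j k)
  where open FinitePointSet P

InH : ∀ {d} → Vector ℝ d → Set
InH u = sum u ≈ 1ℝ

-- The regular simplex S_c and its interior, restricted to points u already
-- known to lie in H_d.
_∈S_ : ∀ {d} → Vector ℝ d → Vector ℝ d → Set
u ∈S c = ∀ i → u i ≤ c i

_∈intS_ : ∀ {d} → Vector ℝ d → Vector ℝ d → Set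
u ∈intS c = ∀ i → u i < c i

PositiveSimplex : ∀ {d} → Vector ℝ d → Set
PositiveSimplex c = 1ℝ ≤ sum c

-- A bare set system because d is arbitrary: for d = 1 and one point, the
-- empty set is not a face.
TDD : ∀ {d} → FinitePointSet d → SetSystem
TDD {d} P = record
  { size = size
  ; Face = λ F → Σ[ c ∈ Vector ℝ d ] PositiveSimplex c
                 × (∀ i → i ∈ F ⇔ point i ∈S c)
                 × (∀ i → ¬ (point i ∈intS c))
  }
  where open FinitePointSet P

IsTDDelaunay : ℕ → SimplicialComplex → Set
IsTDDelaunay d K =
  Σ[ P ∈ FinitePointSet d ]
    (∀ i → InH (FinitePointSet.point P i)) × GeneralPosition P
    × SimplicialComplex.system K ≅ TDD P

record Rectangle : Set where
  field
    lo hi : Vector ℝ 2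
    lo≤hi : ∀ k → lo k ≤ hi k

_∈R_ : Vector ℝ 2 → Rectangle → Set
u ∈R Q = ∀ k → lo k ≤ u k × u k ≤ hi k
  where open Rectangle Q

_∈intR_ : Vector ℝ 2 → Rectangle → Set
u ∈intR Q = ∀ k → lo k < u k × u k < hi k
  where open Rectangle Q

RDSystem : FinitePointSet 2 → SetSystem
RDSystem P = record
  { size = size
  ; Face = λ F → Σ[ Q ∈ Rectangle ]
                   (∀ i → i ∈ F ⇔ point i ∈R Q)
                 × (∀ i → ¬ (point i ∈intR Q))
  }
  where open FinitePointSet P

module ℝ-Lemmas where

  gap : ∀ {x y} θ → 0ℚ ℚ.< θ → ∀ M →
        (∀ m n → M ℕ.≤ m → M ℕ.≤ n → ℚ.∣ seq x m ℚ.- seq x n ∣ ℚ.< θ) →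
        (∀ m n → M ℕ.≤ m → M ℕ.≤ n → ℚ.∣ seq y m ℚ.- seq y n ∣ ℚ.< θ) →
        seq x M ℚ.+ (θ ℚ.+ θ ℚ.+ θ) ℚ.≤ seq y M → x < y
  gap {x} {y} θ 0<θ M p q h = θ , 0<θ , M , λ n M≤n →
    shift (seq x n ℚ.+ θ) (seq y n)
      (ℚ.+-mono-≤ (ℚ.+-mono-≤ (ℚ.<⇒≤ (near⇒> (seq x M) (seq x n) (p M n ℕ.≤-refl M≤n)))
                              (ℚ.<⇒≤ (near⇒< (seq y M) (seq y n) (q M n ℕ.≤-refl M≤n)))) h)
      (solve 5 (λ a b c d t → d :- (a :+ t) :=
         (((c :+ t) :+ (d :+ t)) :+ b) :- ((a :+ b) :+ (c :+ ((t :+ t) :+ t))))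
         refl (seq x n) (seq y M) (seq x M) (seq y n) θ)

  2* 8* : ℚ → ℚ
  2* p = p ℚ.+ p
  8* p = 2* (2* (2* p))

  eighth : ∀ ε → 0ℚ ℚ.< ε → ∃[ θ ] 0ℚ ℚ.< θ × 8* θ ≡ ε
  eighth ε 0<ε =
    ½ ℚ.* (½ ℚ.* (½ ℚ.* ε)) ,
    half (½ ℚ.* (½ ℚ.* ε)) (half (½ ℚ.* ε) (half ε 0<ε)) ,
    trans (cong (λ p → 2* (2* p)) (half+half (½ ℚ.* (½ ℚ.* ε))))
      (trans (cong 2* (half+half (½ ℚ.* ε))) (half+half ε))

  modulus : ∀ x θ → 0ℚ ℚ.< θ → ℕ
  modulus x θ 0<θ = proj₁ (cauchy x θ 0<θ)

  tail : ∀ x θ (0<θ : 0ℚ ℚ.< θ) {M} → modulus x θ 0<θ ℕ.≤ M →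
         ∀ m n → M ℕ.≤ m → M ℕ.≤ n → ℚ.∣ seq x m ℚ.- seq x n ∣ ℚ.< θ
  tail x θ 0<θ N≤M m n M≤m M≤n =
    proj₂ (cauchy x θ 0<θ) m n (ℕ.≤-trans N≤M M≤m) (ℕ.≤-trans N≤M M≤n)

  <-cotrans : ∀ {x y} → x < y → ∀ z → x < z ⊎ z < y
  <-cotrans {x} {y} (ε , 0<ε , N , h) z = split (eighth ε 0<ε)
    where
    split : (∃[ θ ] 0ℚ ℚ.< θ × 8* θ ≡ ε) → x < z ⊎ z < y
    split (θ , 0<θ , refl) = decide (seq x M ℚ.+ 3θ ℚ.≤? seq z M)
      where
      A = modulus x θ 0<θ
      B = modulus y θ 0<θ
      C = modulus z θ 0<θ
      M = N ℕ.⊔ (A ℕ.⊔ (B ℕ.⊔ C))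
      N≤M : N ℕ.≤ M
      N≤M = ℕ.m≤m⊔n N _
      r : A ℕ.⊔ (B ℕ.⊔ C) ℕ.≤ M
      r = ℕ.m≤n⊔m N _
      r′ : B ℕ.⊔ C ℕ.≤ M
      r′ = ≤-⊔ʳ A _ r
      3θ = θ ℚ.+ θ ℚ.+ θ
      0≤2θ : 0ℚ ℚ.+ 0ℚ ℚ.≤ θ ℚ.+ θ
      0≤2θ = ℚ.+-mono-≤ (ℚ.<⇒≤ 0<θ) (ℚ.<⇒≤ 0<θ)
      decide : Dec (seq x M ℚ.+ 3θ ℚ.≤ seq z M) → x < z ⊎ z < y
      decide (yes le) = inj₁ (gap {x} {z} θ 0<θ M
        (tail x θ 0<θ (≤-⊔ˡ A _ r)) (tail z θ 0<θ (≤-⊔ʳ B C r′)) le)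
      decide (no ¬le) = inj₂ (gap {z} {y} θ 0<θ M
        (tail z θ 0<θ (≤-⊔ʳ B C r′)) (tail y θ 0<θ (≤-⊔ˡ B C r′))
        (shift (seq z M ℚ.+ 3θ) (seq y M)
          (ℚ.+-mono-≤ (ℚ.+-mono-≤ (ℚ.<⇒≤ (ℚ.≰⇒> ¬le)) (h M N≤M)) 0≤2θ)
          (solve 4 (λ a b c t →
             let 2t = t :+ t; 4t = 2t :+ 2t; e = 4t :+ 4t in
             b :- (c :+ ((t :+ t) :+ t)) :=
             (((a :+ ((t :+ t) :+ t)) :+ b) :+ (t :+ t)) :- ((c :+ (a :+ e)) :+ (con 0ℚ :+ con 0ℚ)))
             refl (seq x M) (seq y M) (seq z M) θ)))

  ≤-antisym : ∀ {x y} → x ≤ y → y ≤ x → x ≈ y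
  ≤-antisym {x} {y} x≤y y≤x ε 0<ε = split (eighth ε 0<ε)
    where
    split : (∃[ θ ] 0ℚ ℚ.< θ × 8* θ ≡ ε) →
            ∃[ N ] (∀ n → N ℕ.≤ n → ℚ.∣ seq x n ℚ.- seq y n ∣ ℚ.< ε)
    split (θ , 0<θ , refl) = M , λ n M≤n →
      <⇒near (seq x n) (seq y n)
        (bound x y n (p n M≤n) (q′ n M≤n) x≤y (tail y θ 0<θ B≤M) (tail x θ 0<θ A≤M))
        (bound y x n (q n M≤n) (p′ n M≤n) y≤x (tail x θ 0<θ A≤M) (tail y θ 0<θ B≤M))
      where
      A = modulus x θ 0<θ
      B = modulus y θ 0<θ
      M = A ℕ.⊔ B
      A≤M : A ℕ.≤ M
      A≤M = ℕ.m≤m⊔n A B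
      B≤M : B ℕ.≤ M
      B≤M = ℕ.m≤n⊔m A B
      p : ∀ n → M ℕ.≤ n → seq x n ℚ.< seq x M ℚ.+ θ
      p n M≤n = near⇒< (seq x n) (seq x M) (tail x θ 0<θ A≤M n M M≤n ℕ.≤-refl)
      p′ : ∀ n → M ℕ.≤ n → seq x M ℚ.< seq x n ℚ.+ θ
      p′ n M≤n = near⇒> (seq x n) (seq x M) (tail x θ 0<θ A≤M n M M≤n ℕ.≤-refl)
      q : ∀ n → M ℕ.≤ n → seq y n ℚ.< seq y M ℚ.+ θ
      q n M≤n = near⇒< (seq y n) (seq y M) (tail y θ 0<θ B≤M n M M≤n ℕ.≤-refl)
      q′ : ∀ n → M ℕ.≤ n → seq y M ℚ.< seq y n ℚ.+ θ
      q′ n M≤n = near⇒> (seq y n) (seq y M) (tail y θ 0<θ B≤M n M M≤n ℕ.≤-refl)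
      bound : ∀ u v n → seq u n ℚ.< seq u M ℚ.+ θ → seq v M ℚ.< seq v n ℚ.+ θ → u ≤ v →
              (∀ m n → M ℕ.≤ m → M ℕ.≤ n → ℚ.∣ seq v m ℚ.- seq v n ∣ ℚ.< θ) →
              (∀ m n → M ℕ.≤ m → M ℕ.≤ n → ℚ.∣ seq u m ℚ.- seq u n ∣ ℚ.< θ) →
              seq u n ℚ.< seq v n ℚ.+ 8* θ
      bound u v n a b u≤v tv tu with seq v M ℚ.+ (θ ℚ.+ θ ℚ.+ θ) ℚ.≤? seq u M
      ... | yes le = ⊥-elim (u≤v (gap {v} {u} θ 0<θ M tv tu le))
      ... | no ¬le = shift-< (seq u n) (seq v n ℚ.+ 8* θ)
        (ℚ.+-mono-< (ℚ.+-mono-< a b)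
          (ℚ.+-mono-< (ℚ.≰⇒> ¬le) (ℚ.+-mono-< 0<θ (ℚ.+-mono-< 0<θ 0<θ))))
        (solve 5 (λ a b c d t →
           let 2t = t :+ t; 4t = 2t :+ 2t; e = 4t :+ 4t in
           (d :+ e) :- a :=
           (((b :+ t) :+ (d :+ t)) :+ ((c :+ ((t :+ t) :+ t)) :+ (t :+ (t :+ t))))
             :- ((a :+ c) :+ (b :+ (con 0ℚ :+ (con 0ℚ :+ con 0ℚ)))))
           refl (seq u n) (seq u M) (seq v M) (seq v n) θ)

  ≤-trans : ∀ {x y z} → x ≤ y → y ≤ z → x ≤ z
  ≤-trans {x} {y} {z} x≤y y≤z z<x = [ y≤z , x≤y ]′ (<-cotrans {z} {x} z<x y)

  <-≤-trans : ∀ {x y z} → x < y → y ≤ z → x < z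
  <-≤-trans {x} {y} {z} x<y y≤z = [ id , ⊥-elim ∘ y≤z ]′ (<-cotrans {x} {y} x<y z)

  ≤-<-trans : ∀ {x y z} → x ≤ y → y < z → x < z
  ≤-<-trans {x} {y} {z} x≤y y<z = [ ⊥-elim ∘ x≤y , id ]′ (<-cotrans {y} {z} y<z x)

  p+ε≰p : ∀ p ε → 0ℚ ℚ.< ε → ¬ (p ℚ.+ ε ℚ.≤ p)
  p+ε≰p p ε 0<ε le = ℚ.<-irrefl refl (ℚ.<-≤-trans 0<ε (shift ε 0ℚ le
    (solve 2 (λ p e → con 0ℚ :- e := p :- (p :+ e)) refl p ε)))

  <-irrefl : ∀ x → ¬ (x < x)
  <-irrefl x (ε , 0<ε , N , h) = p+ε≰p (seq x N) ε 0<ε (h N ℕ.≤-refl)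

  ≤-refl : ∀ x → x ≤ x
  ≤-refl = <-irrefl

  <⇒≤ : ∀ {x y} → x < y → x ≤ y
  <⇒≤ {x} {y} (ε , 0<ε , M , h) (δ , 0<δ , N , k) = <-irrefl x
    (ε , 0<ε , M ℕ.⊔ N , λ n b → ℚ.≤-trans (h n (≤-⊔ˡ M N b))
      (ℚ.≤-trans (shift (seq y n) (seq y n ℚ.+ δ) (ℚ.<⇒≤ 0<δ)
        (solve 2 (λ p e → (p :+ e) :- p := e :- con 0ℚ) refl (seq y n) δ)) (k n (≤-⊔ʳ M N b))))

  ≤∧≉⇒¬¬< : ∀ {x y} → x ≤ y → ¬ (x ≈ y) → ¬ ¬ (x < y)
  ≤∧≉⇒¬¬< {x} {y} x≤y x≉y x≮y = x≉y (≤-antisym {x} {y} x≤y x≮y)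

  x<-y⇒y<-x : ∀ {x y} → x < - y → y < - x
  x<-y⇒y<-x {x} {y} (ε , 0<ε , N , h) = ε , 0<ε , N , λ n N≤n →
    shift (seq y n ℚ.+ ε) (ℚ.- seq x n) (h n N≤n)
      (solve 3 (λ a b e → (:- a) :- (b :+ e) := (:- b) :- (a :+ e)) refl (seq x n) (seq y n) ε)

  -x<y⇒-y<x : ∀ {x y} → - x < y → - y < x
  -x<y⇒-y<x {x} {y} (ε , 0<ε , N , h) = ε , 0<ε , N , λ n N≤n →
    shift (ℚ.- seq y n ℚ.+ ε) (seq x n) (h n N≤n)
      (solve 3 (λ a b e → a :- ((:- b) :+ e) := b :- ((:- a) :+ e)) refl (seq x n) (seq y n) ε)

  -x<-y⇒y<x : ∀ {x y} → - x < - y → y < x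
  -x<-y⇒y<x {x} {y} (ε , 0<ε , N , h) = ε , 0<ε , N , λ n N≤n →
    shift (seq y n ℚ.+ ε) (seq x n) (h n N≤n)
      (solve 3 (λ a b e → a :- (b :+ e) := (:- b) :- ((:- a) :+ e)) refl (seq x n) (seq y n) ε)

  -x≈-y⇒x≈y : ∀ {x y} → - x ≈ - y → x ≈ y
  -x≈-y⇒x≈y {x} {y} h ε 0<ε = proj₁ (h ε 0<ε) , λ n N≤n → subst (ℚ._< ε)
    (trans (cong ℚ.∣_∣ (solve 2 (λ a b → (:- a) :- (:- b) := :- (a :- b)) refl (seq x n) (seq y n)))
      (ℚ.∣-p∣≡∣p∣ (seq x n ℚ.- seq y n)))
    (proj₂ (h ε 0<ε) n N≤n)

  _⊔_ : ℝ → ℝ → ℝ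
  x ⊔ y = mkℝ (λ n → seq x n ℚ.⊔ seq y n) λ ε 0<ε →
    let M = modulus x ε 0<ε
        N = modulus y ε 0<ε
        p = tail x ε 0<ε (ℕ.m≤m⊔n M N)
        q = tail y ε 0<ε (ℕ.m≤n⊔m M N)
        bound : ∀ m n → M ℕ.⊔ N ℕ.≤ m → M ℕ.⊔ N ℕ.≤ n →
                seq x m ℚ.⊔ seq y m ℚ.< (seq x n ℚ.⊔ seq y n) ℚ.+ ε
        bound m n a b = lub
          (ℚ.<-≤-trans (near⇒< (seq x m) (seq x n) (p m n a b)) (ℚ.+-monoˡ-≤ ε (ℚ.p≤p⊔q (seq x n) (seq y n))))
          (ℚ.<-≤-trans (near⇒< (seq y m) (seq y n) (q m n a b)) (ℚ.+-monoˡ-≤ ε (ℚ.p≤q⊔p (seq x n) (seq y n))))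
    in M ℕ.⊔ N , λ m n a b → <⇒near (seq x m ℚ.⊔ seq y m) (seq x n ℚ.⊔ seq y n) (bound m n a b) (bound n m b a)
    where
    lub : ∀ {p q r} → p ℚ.< r → q ℚ.< r → p ℚ.⊔ q ℚ.< r
    lub {p} {q} {r} a b with ℚ.⊔-sel p q
    ... | inj₁ eq = subst (ℚ._< r) (sym eq) a
    ... | inj₂ eq = subst (ℚ._< r) (sym eq) b

  x≤x⊔y : ∀ x y → x ≤ (x ⊔ y)
  x≤x⊔y x y (ε , 0<ε , N , h) = p+ε≰p (seq x N) ε 0<ε
    (ℚ.≤-trans (ℚ.+-monoˡ-≤ ε (ℚ.p≤p⊔q (seq x N) (seq y N))) (h N ℕ.≤-refl))

  y≤x⊔y : ∀ x y → y ≤ (x ⊔ y)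
  y≤x⊔y x y (ε , 0<ε , N , h) = p+ε≰p (seq y N) ε 0<ε
    (ℚ.≤-trans (ℚ.+-monoˡ-≤ ε (ℚ.p≤q⊔p (seq x N) (seq y N))) (h N ℕ.≤-refl))

  ⊔-lub-< : ∀ {x y z} → x < z → y < z → (x ⊔ y) < z
  ⊔-lub-< {x} {y} {z} (ε , 0<ε , M , h) (δ , 0<δ , N , k) =
    ε ℚ.⊓ δ , 0<ε⊓δ , M ℕ.⊔ N , bound
    where
    0<ε⊓δ : 0ℚ ℚ.< ε ℚ.⊓ δ
    0<ε⊓δ with ℚ.⊓-sel ε δ
    ... | inj₁ eq = subst (0ℚ ℚ.<_) (sym eq) 0<ε
    ... | inj₂ eq = subst (0ℚ ℚ.<_) (sym eq) 0<δ
    bound : ∀ n → M ℕ.⊔ N ℕ.≤ n → (seq x n ℚ.⊔ seq y n) ℚ.+ (ε ℚ.⊓ δ) ℚ.≤ seq z n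
    bound n b with ℚ.⊔-sel (seq x n) (seq y n)
    ... | inj₁ eq = subst (λ m → m ℚ.+ (ε ℚ.⊓ δ) ℚ.≤ seq z n) (sym eq)
      (ℚ.≤-trans (ℚ.+-monoʳ-≤ (seq x n) (ℚ.p⊓q≤p ε δ)) (h n (≤-⊔ˡ M N b)))
    ... | inj₂ eq = subst (λ m → m ℚ.+ (ε ℚ.⊓ δ) ℚ.≤ seq z n) (sym eq)
      (ℚ.≤-trans (ℚ.+-monoʳ-≤ (seq y n) (ℚ.p⊓q≤q ε δ)) (k n (≤-⊔ʳ M N b)))

  x<x+1 : ∀ x → x < x + 1ℝ
  x<x+1 x = 1ℚ , ℚ.positive⁻¹ 1ℚ , 0 , λ _ _ → ℚ.≤-refl

  ⊔-lub-≤ : ∀ {x y z} → x ≤ z → y ≤ z → (x ⊔ y) ≤ z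
  ⊔-lub-≤ {x} {y} {z} x≤z y≤z z<x⊔y = <-irrefl (x ⊔ y) (⊔-lub-< {x} {y} {x ⊔ y}
    (≤-<-trans {x} {z} {x ⊔ y} x≤z z<x⊔y) (≤-<-trans {y} {z} {x ⊔ y} y≤z z<x⊔y))

  sup : ∀ {n} → ℝ → Subset n → Vector ℝ n → ℝ
  sup b []          f = b
  sup b (true  ∷ F) f = f zero ⊔ sup b F (f ∘ suc)
  sup b (false ∷ F) f = sup b F (f ∘ suc)

  sup-upper : ∀ {n} b (F : Subset n) f → ∀ i → i ∈ F → f i ≤ sup b F f
  sup-upper b (true ∷ F) f zero here = x≤x⊔y (f zero) (sup b F (f ∘ suc))
  sup-upper b (true ∷ F) f (suc i) (there i∈F) =
    ≤-trans {f (suc i)} {sup b F (f ∘ suc)} {f zero ⊔ sup b F (f ∘ suc)} (sup-upper b F (f ∘ suc) i i∈F)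
      (y≤x⊔y (f zero) (sup b F (f ∘ suc)))
  sup-upper b (false ∷ F) f (suc i) (there i∈F) = sup-upper b F (f ∘ suc) i i∈F

  sup-lub-≤ : ∀ {n} b (F : Subset n) f z → b ≤ z → (∀ i → i ∈ F → f i ≤ z) → sup b F f ≤ z
  sup-lub-≤ b [] f z b≤z h = b≤z
  sup-lub-≤ b (true ∷ F) f z b≤z h =
    ⊔-lub-≤ {f zero} {sup b F (f ∘ suc)} {z} (h zero here)
      (sup-lub-≤ b F (f ∘ suc) z b≤z (λ i → h (suc i) ∘ there))
  sup-lub-≤ b (false ∷ F) f z b≤z h = sup-lub-≤ b F (f ∘ suc) z b≤z (λ i → h (suc i) ∘ there)

  sup-lub-< : ∀ {n} b (F : Subset n) f z → b < z → (∀ i → i ∈ F → f i < z) → sup b F f < z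
  sup-lub-< b [] f z b<z h = b<z
  sup-lub-< b (true ∷ F) f z b<z h =
    ⊔-lub-< {f zero} {sup b F (f ∘ suc)} {z} (h zero here)
      (sup-lub-< b F (f ∘ suc) z b<z (λ i → h (suc i) ∘ there))
  sup-lub-< b (false ∷ F) f z b<z h = sup-lub-< b F (f ∘ suc) z b<z (λ i → h (suc i) ∘ there)

  ¬¬-all : ∀ {n} {A : Fin n → Set} → (∀ i → ¬ ¬ A i) → ¬ ¬ (∀ i → A i)
  ¬¬-all {zero}  h k = k λ ()
  ¬¬-all {suc n} h k = h zero λ a → ¬¬-all (h ∘ suc) λ as →
    k λ { zero → a ; (suc i) → as i }

  strictly-below : ∀ {n} (G : Subset n) f z g₀ → g₀ ∈ G → (∀ g → g ∈ G → f g ≤ z) →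
                   ∀ i → f i ≤ sup (f g₀) G f → (∀ g → g ∈ G → ¬ (f g ≈ f i)) → ¬ ¬ (f i < z)
  strictly-below G f z g₀ g₀∈G G≤z i fi≤sup G≉fi fi≮z =
    ¬¬-all below λ G<fi → fi≤sup (sup-lub-< (f g₀) G f (f i) (G<fi g₀ g₀∈G) G<fi)
    where
    below : ∀ g → ¬ ¬ (g ∈ G → f g < f i)
    below g k with g ∈? G
    ... | no  g∉G = k (⊥-elim ∘ g∉G)
    ... | yes g∈G = ≤∧≉⇒¬¬< {f g} {f i} (≤-trans {f g} {z} {f i} (G≤z g g∈G) fi≮z) (G≉fi g g∈G)
                      (λ fg<fi → k (λ _ → fg<fi))

open ℝ-Lemmas

module _ (P : FinitePointSet 2) (gp : GeneralPosition P) where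
  open FinitePointSet P
  open SetSystem (RDSystem P) using (Face)

  private
    nowhere : ∀ {G} → ¬ Nonempty G → Face G
    nowhere {G} empty = Q , (λ i → mk⇔ (λ i∈G → ⊥-elim (empty (i , i∈G)))
                                        (λ i∈Q → ⊥-elim (proj₁ (i∈Q zero) (far i))))
                          , (λ i i∈Q → <⇒≤ {b} {point i zero} (proj₁ (i∈Q zero)) (far i))
      where
      m = sup 0ℝ ⊤ (λ i → point i zero)
      b = m + 1ℝ
      far : ∀ i → point i zero < b
      far i = ≤-<-trans {point i zero} {m} {b} (sup-upper 0ℝ ⊤ (λ j → point j zero) i ∈⊤) (x<x+1 m)
      Q : Rectangle
      Q = record { lo = λ _ → b ; hi = λ _ → b ; lo≤hi = λ _ → ≤-refl b }

    boundingBox : ∀ {F G} g₀ → g₀ ∈ G → G ⊆ F → Face F → Face G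
    boundingBox {F} {G} g₀ g₀∈G G⊆F (Q , F⇔Q , Q-empty) =
      B , (λ i → mk⇔ (λ i∈G k → lo≤ i i∈G k , ≤hi i i∈G k) (inside i)) ,
      (λ i i∈B → Q-empty i λ k →
        ≤-<-trans {lo k} {lo′ k} {point i k} (lo≤lo′ k) (proj₁ (i∈B k)) ,
        <-≤-trans {point i k} {hi′ k} {hi k} (proj₂ (i∈B k)) (hi′≤hi k))
      where
      open Rectangle Q
      x -x : Fin 2 → Vector ℝ size
      x  k i = point i k
      -x k i = - point i k
      lo′ hi′ : Vector ℝ 2
      lo′ k = - sup (-x k g₀) G (-x k)
      hi′ k = sup (x k g₀) G (x k)
      lo≤ : ∀ i → i ∈ G → ∀ k → lo′ k ≤ point i k
      lo≤ i i∈G k h = sup-upper (-x k g₀) G (-x k) i i∈G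
        (x<-y⇒y<-x {point i k} {sup (-x k g₀) G (-x k)} h)
      ≤hi : ∀ i → i ∈ G → ∀ k → point i k ≤ hi′ k
      ≤hi i i∈G k = sup-upper (x k g₀) G (x k) i i∈G
      inQ : ∀ i → i ∈ G → point i ∈R Q
      inQ i i∈G = Equivalence.to (F⇔Q i) (G⊆F i∈G)
      -x≤-lo : ∀ k i → i ∈ G → -x k i ≤ - lo k
      -x≤-lo k i i∈G h = proj₁ (inQ i i∈G k) (-x<-y⇒y<x {lo k} {point i k} h)
      lo≤lo′ : ∀ k → lo k ≤ lo′ k
      lo≤lo′ k h = sup-lub-≤ (-x k g₀) G (-x k) (- lo k) (-x≤-lo k g₀ g₀∈G) (-x≤-lo k)
        (-x<y⇒-y<x {sup (-x k g₀) G (-x k)} {lo k} h)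
      hi′≤hi : ∀ k → hi′ k ≤ hi k
      hi′≤hi k = sup-lub-≤ (x k g₀) G (x k) (hi k) (proj₂ (inQ g₀ g₀∈G k))
        (λ i i∈G → proj₂ (inQ i i∈G k))
      B : Rectangle
      B = record
        { lo = lo′ ; hi = hi′
        ; lo≤hi = λ k → ≤-trans {lo′ k} {point g₀ k} {hi′ k} (lo≤ g₀ g₀∈G k) (≤hi g₀ g₀∈G k)
        }
      -- A point of B outside G differs from every point of G in both
      -- coordinates, so it would lie in the interior of Q.
      inside : ∀ i → point i ∈R B → i ∈ G
      inside i i∈B = decidable-stable (i ∈? G) λ i∉G →
        ¬¬-all (interior i∉G) (Q-empty i)
        where
        interior : i ∉ G → ∀ k → ¬ ¬ (lo k < point i k × point i k < hi k)
        interior i∉G k κ =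
          strictly-below G (-x k) (- lo k) g₀ g₀∈G (-x≤-lo k) i
            (λ h → proj₁ (i∈B k) (-x<y⇒-y<x′ h))
            (λ g g∈G eq → other g g∈G (-x≈-y⇒x≈y {point g k} {point i k} eq)) λ l →
          strictly-below G (x k) (hi k) g₀ g₀∈G (λ g g∈G → proj₂ (inQ g g∈G k)) i
            (proj₂ (i∈B k)) other λ u →
          κ (-x<-y⇒y<x {point i k} {lo k} l , u)
          where
          other : ∀ g → g ∈ G → ¬ (point g k ≈ point i k)
          other g g∈G = gp (λ { refl → i∉G g∈G }) k
          -x<y⇒-y<x′ : sup (-x k g₀) G (-x k) < - point i k → point i k < lo′ k
          -x<y⇒-y<x′ = x<-y⇒y<-x {sup (-x k g₀) G (-x k)} {point i k}

    downClosed : ∀ {F G} → G ⊆ F → Face F → Face G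
    downClosed {F} {G} G⊆F face with nonempty? G
    ... | yes (g₀ , g₀∈G) = boundingBox g₀ g₀∈G G⊆F face
    ... | no empty        = nowhere empty

    vertex : ∀ v → Face ⁅ v ⁆
    vertex v = Q , (λ i → mk⇔ (λ i∈v → subst (λ j → point j ∈R Q) (sym (x∈⁅y⁆⇒x≡y v i∈v))
                                         (λ k → ≤-refl (point v k) , ≤-refl (point v k)))
                              (unique i))
                 , (λ i i∈Q → <⇒≤ {point v zero} {point i zero} (proj₁ (i∈Q zero)) (proj₂ (i∈Q zero)))
      where
      Q : Rectangle
      Q = record { lo = point v ; hi = point v ; lo≤hi = λ k → ≤-refl (point v k) }
      unique : ∀ i → point i ∈R Q → i ∈ ⁅ v ⁆
      unique i i∈Q with i Fin.≟ v
      ... | yes refl = x∈⁅x⁆ v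
      ... | no  i≢v  = ⊥-elim (gp i≢v zero
        (≤-antisym {point i zero} {point v zero} (proj₂ (i∈Q zero)) (proj₁ (i∈Q zero))))

  RD : SimplicialComplex
  RD = record
    { system    = RDSystem P
    ; isComplex = record { vertex = vertex ; downClosed = downClosed }
    }

{-# OPTIONS --safe #-}

-- Lift (x , y) to (x + 1 , - x , y , - y), which lies in H₄. A rectangle
-- [a , b] × [a′ , b′] then cuts out the same points as the regular simplex S_c
-- with c = (b + 1 , - a , b′ , - a′), and so do their interiors. Since c sums to
-- 1 + (b - a) + (b′ - a′), this simplex is positive. Conversely, a positive
-- simplex may come from "intervals" with b < a, but it then contains no lifted
-- point, and the empty set is a face of every R-Delaunay complex anyway.

module Submission where

open import Defs

open import Data.Empty using (⊥-elim)
open import Data.Fin.Patterns using (0F; 1F; 2F; 3F)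
open import Data.Fin.Subset using (⊤; Nonempty)
open import Data.Fin.Subset.Properties using (nonempty?; ∈⊤)
open import Data.Product.Base using (_×_; _,_; proj₁; proj₂)
open import Data.Rational.Base as ℚ using (0ℚ; 1ℚ)
import Data.Rational.Properties as ℚ
open import Data.Rational.Solver using (module +-*-Solver)
open import Data.Sum.Base using ([_,_]′)
open import Data.Vec.Functional using (Vector)
open import Data.Vec.Properties using (tabulate∘lookup)
open import Function.Base using (_∘_)
open import Function.Bundles using (_⇔_; mk⇔; module Equivalence)
open import Function.Construct.Composition using (_⇔-∘_)
open import Function.Construct.Identity using (↔-id)
open import Relation.Binary.PropositionalEquality
  using (_≡_; _≢_; refl; sym; trans; cong; subst)
open import Relation.Nullary using (¬_; yes; no)

open +-*-Solver using (solve; con; _:+_; :-_; _:-_; _:=_)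
open ℚ-Lemmas using (shift)
open ℝ-Lemmas using (<-cotrans; ≤-trans; ≤-refl; -x≈-y⇒x≈y)

-- Both orders depend only on the difference of their arguments. Asking for equality at every index,
-- rather than up to `≈`, leaves rational identities that the ring solver can prove.
Diff≡ : ℝ → ℝ → ℝ → ℝ → Set
Diff≡ x y x′ y′ = ∀ n → seq y n ℚ.- seq x n ≡ seq y′ n ℚ.- seq x′ n

<-resp-Diff≡ : ∀ x y x′ y′ → Diff≡ x y x′ y′ → x < y → x′ < y′
<-resp-Diff≡ x y x′ y′ e (ε , 0<ε , N , h) = ε , 0<ε , N , λ n N≤n →
  shift (seq x′ n ℚ.+ ε) (seq y′ n) (h n N≤n)
    (trans (split (seq x′ n) (seq y′ n) ε)
      (trans (cong (ℚ._- ε) (sym (e n))) (sym (split (seq x n) (seq y n) ε))))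
  where
  split : ∀ a b t → b ℚ.- (a ℚ.+ t) ≡ (b ℚ.- a) ℚ.- t
  split = solve 3 (λ a b t → b :- (a :+ t) := (b :- a) :- t) refl

<-cong-Diff≡ : ∀ x y x′ y′ → Diff≡ x y x′ y′ → (x < y) ⇔ (x′ < y′)
<-cong-Diff≡ x y x′ y′ e = mk⇔ (<-resp-Diff≡ x y x′ y′ e)
  (<-resp-Diff≡ x′ y′ x y (sym ∘ e))

≤-cong-Diff≡ : ∀ x y x′ y′ → Diff≡ x y x′ y′ → (x ≤ y) ⇔ (x′ ≤ y′)
≤-cong-Diff≡ x y x′ y′ e = mk⇔ (_∘ from) (_∘ to)
  where
  swap : ∀ a b → a ℚ.- b ≡ ℚ.- (b ℚ.- a)
  swap = solve 2 (λ a b → a :- b := :- (b :- a)) refl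
  -- Since `≤` negates the reversed `<`, the equivalence is applied to the differences with opposite
  -- sign.
  open Equivalence (<-cong-Diff≡ y x y′ x′ λ n →
    trans (swap (seq x n) (seq y n))
      (trans (cong ℚ.-_ (e n)) (sym (swap (seq x′ n) (seq y′ n)))))

seq≡⇒≈ : ∀ x y → (∀ n → seq x n ≡ seq y n) → x ≈ y
seq≡⇒≈ x y e ε 0<ε = 0 , λ n _ → subst (ℚ._< ε)
  (cong ℚ.∣_∣ (sym (trans (cong (ℚ._- seq y n) (e n)) (ℚ.+-inverseʳ (seq y n))))) 0<ε

+-cancelʳ-≈ : ∀ z x y → x + z ≈ y + z → x ≈ y
+-cancelʳ-≈ z x y h ε 0<ε = proj₁ (h ε 0<ε) , λ n N≤n → subst (ℚ._< ε)
  (cong ℚ.∣_∣ (solve 3 (λ a b t → (a :+ t) :- (b :+ t) := a :- b) refl (seq x n) (seq y n) (seq z n)))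
  (proj₂ (h ε 0<ε) n N≤n)

corner : Vector ℝ 2 → Vector ℝ 2 → Vector ℝ 4
corner lo hi 0F = hi 0F + 1ℝ
corner lo hi 1F = - lo 0F
corner lo hi 2F = hi 1F
corner lo hi 3F = - lo 1F

-- A point is treated as a degenerate rectangle, so that comparing it with `corner lo hi` coordinate
-- by coordinate cancels the shift by one.
lift : Vector ℝ 2 → Vector ℝ 4
lift u = corner u u

lift∈H : ∀ u → InH (lift u)
lift∈H u = seq≡⇒≈ (sum (lift u)) 1ℝ λ n →
  solve 2 (λ a b → (a :+ con 1ℚ) :+ ((:- a) :+ (b :+ ((:- b) :+ con 0ℚ))) := con 1ℚ) refl
    (seq (u 0F) n) (seq (u 1F) n)

-- If the sum were below 1, one of the two side lengths would be negative. Cotransitivity at `mid`,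
-- which is 1 plus the first side length, tells which one.
corner-positive : ∀ lo hi → (∀ k → lo k ≤ hi k) → PositiveSimplex (corner lo hi)
corner-positive lo hi lo≤hi c<1 =
  [ lo≤hi 1F ∘ <-resp-Diff≡ c mid (hi 1F) (lo 1F) (λ n →
      solve 4 (λ a b a′ b′ → ((b :+ con 1ℚ) :- a) :-
          ((b :+ con 1ℚ) :+ ((:- a) :+ (b′ :+ ((:- a′) :+ con 0ℚ)))) := a′ :- b′) refl
        (seq (lo 0F) n) (seq (hi 0F) n) (seq (lo 1F) n) (seq (hi 1F) n))
  , lo≤hi 0F ∘ <-resp-Diff≡ mid 1ℝ (hi 0F) (lo 0F) (λ n →
      solve 2 (λ a b → con 1ℚ :- ((b :+ con 1ℚ) :- a) := a :- b) refl
        (seq (lo 0F) n) (seq (hi 0F) n))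
  ]′ (<-cotrans {c} {1ℝ} c<1 mid)
  where
  c mid : ℝ
  c   = sum (corner lo hi)
  mid = (hi 0F + 1ℝ) + (- lo 0F)

-- Weaker than an equality of vectors of reals: bounds recovered from an arbitrary `c` give back
-- entries such as `- (- c 1F)`, which agree with `c` only index by index.
IsCorner : Vector ℝ 4 → Vector ℝ 2 → Vector ℝ 2 → Set
IsCorner c lo hi = ∀ i n → seq (c i) n ≡ seq (corner lo hi i) n

module _ (c : Vector ℝ 4) (lo hi : Vector ℝ 2) (c≡ : IsCorner c lo hi) (u : Vector ℝ 2) where

  private
    upper-diff : ∀ i x y → Diff≡ (lift u i) (corner lo hi i) x y → Diff≡ (lift u i) (c i) x y
    upper-diff i x y e n = trans (cong (ℚ._- seq (lift u i) n) (c≡ i n)) (e n)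

    diff₀ : Diff≡ (lift u 0F) (c 0F) (u 0F) (hi 0F)
    diff₀ = upper-diff 0F (u 0F) (hi 0F) λ n →
      solve 2 (λ a b → (b :+ con 1ℚ) :- (a :+ con 1ℚ) := b :- a) refl
        (seq (u 0F) n) (seq (hi 0F) n)

    diff₁ : Diff≡ (lift u 1F) (c 1F) (lo 0F) (u 0F)
    diff₁ = upper-diff 1F (lo 0F) (u 0F) λ n →
      solve 2 (λ a b → (:- b) :- (:- a) := a :- b) refl (seq (u 0F) n) (seq (lo 0F) n)

    diff₂ : Diff≡ (lift u 2F) (c 2F) (u 1F) (hi 1F)
    diff₂ = upper-diff 2F (u 1F) (hi 1F) λ n → refl

    diff₃ : Diff≡ (lift u 3F) (c 3F) (lo 1F) (u 1F)
    diff₃ = upper-diff 3F (lo 1F) (u 1F) λ n →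
      solve 2 (λ a b → (:- b) :- (:- a) := a :- b) refl (seq (u 1F) n) (seq (lo 1F) n)

    -- Abstracting the relation treats the simplex and its interior at once. Entries `0F` and `2F`
    -- encode the upper bounds, the negated entries `1F` and `3F` the lower ones.
    transport : (_∼_ : ℝ → ℝ → Set) →
                (∀ x y x′ y′ → Diff≡ x y x′ y′ → (x ∼ y) ⇔ (x′ ∼ y′)) →
                (∀ k → (lo k ∼ u k) × (u k ∼ hi k)) ⇔ (∀ i → lift u i ∼ c i)
    transport _∼_ cong-∼ = mk⇔
      (λ h → λ { 0F → from e₀ (proj₂ (h 0F)) ; 1F → from e₁ (proj₁ (h 0F))
               ; 2F → from e₂ (proj₂ (h 1F)) ; 3F → from e₃ (proj₁ (h 1F)) })
      (λ h → λ { 0F → to e₁ (h 1F) , to e₀ (h 0F) ; 1F → to e₃ (h 3F) , to e₂ (h 2F) })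
      where
      open Equivalence using (to; from)
      e₀ = cong-∼ (lift u 0F) (c 0F) (u 0F) (hi 0F) diff₀
      e₁ = cong-∼ (lift u 1F) (c 1F) (lo 0F) (u 0F) diff₁
      e₂ = cong-∼ (lift u 2F) (c 2F) (u 1F) (hi 1F) diff₂
      e₃ = cong-∼ (lift u 3F) (c 3F) (lo 1F) (u 1F) diff₃

  box⇔simplex : (∀ k → lo k ≤ u k × u k ≤ hi k) ⇔ (lift u ∈S c)
  box⇔simplex = transport _≤_ ≤-cong-Diff≡

  box⇔simplex-interior : (∀ k → lo k < u k × u k < hi k) ⇔ (lift u ∈intS c)
  box⇔simplex-interior = transport _<_ <-cong-Diff≡

module _ (P : FinitePointSet 2) (gp : GeneralPosition P) where
  open FinitePointSet P
  open SimplicialComplex (RD P gp) using (vertex; downClosed)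

  lifted-gp : ∀ {i j} → i ≢ j → ∀ k → ¬ (lift (point i) k ≈ lift (point j) k)
  lifted-gp {i} {j} i≢j 0F = gp i≢j 0F ∘ +-cancelʳ-≈ 1ℝ (point i 0F) (point j 0F)
  lifted-gp {i} {j} i≢j 1F = gp i≢j 0F ∘ -x≈-y⇒x≈y {point i 0F} {point j 0F}
  lifted-gp {i} {j} i≢j 2F = gp i≢j 1F
  lifted-gp {i} {j} i≢j 3F = gp i≢j 1F ∘ -x≈-y⇒x≈y {point i 1F} {point j 1F}

  lifted : FinitePointSet 4
  lifted = record
    { size     = size
    ; point    = lift ∘ point
    ; distinct = λ i≢j eq → lifted-gp i≢j 0F (eq 0F)
    }

  open SetSystem (RDSystem P) using (Face)
  open SetSystem (TDD lifted) using () renaming (Face to TDFace)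

  -- If some point exists, an empty `F` lies inside its vertex face; otherwise any rectangle
  -- satisfies the conditions vacuously.
  empty-face : ∀ {F} → ¬ Nonempty F → Face F
  empty-face empty with nonempty? {size} ⊤
  ... | yes (v , _) = downClosed (λ i∈F → ⊥-elim (empty (_ , i∈F))) (vertex v)
  ... | no  noPoint =
    record { lo = λ _ → 0ℝ ; hi = λ _ → 0ℝ ; lo≤hi = λ _ → ≤-refl 0ℝ } ,
    (λ i → ⊥-elim (noPoint (i , ∈⊤))) , (λ i → ⊥-elim (noPoint (i , ∈⊤)))

  rectangle⇒simplex : ∀ {F} → Face F → TDFace F
  rectangle⇒simplex (Q , F⇔Q , Q-empty) =
    corner lo hi , corner-positive lo hi lo≤hi ,
    (λ i → box⇔simplex (corner lo hi) lo hi (λ _ _ → refl) (point i) ⇔-∘ F⇔Q i) ,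
    (λ i → Q-empty i ∘ Equivalence.from
      (box⇔simplex-interior (corner lo hi) lo hi (λ _ _ → refl) (point i)))
    where open Rectangle Q

  simplex⇒rectangle : ∀ {F} → TDFace F → Face F
  simplex⇒rectangle {F} (c , _ , F⇔S , S-empty) with nonempty? F
  ... | no  empty      = empty-face empty
  ... | yes (v , v∈F) =
    record { lo = lo ; hi = hi ; lo≤hi = lo≤hi } ,
    (λ i → mk⇔ (from (box i) ∘ to (F⇔S i)) (from (F⇔S i) ∘ to (box i))) ,
    (λ i → S-empty i ∘ to (box⇔simplex-interior c lo hi c≡ (point i)))
    where
    open Equivalence using (to; from)
    -- These bounds solve `c = corner lo hi` entry by entry.
    lo hi : Vector ℝ 2
    lo 0F = - c 1F
    lo 1F = - c 3F
    hi 0F = c 0F + (- 1ℝ)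
    hi 1F = c 2F
    -‿involutive : ∀ a → a ≡ ℚ.- (ℚ.- a)
    -‿involutive = solve 1 (λ a → a := :- (:- a)) refl
    c≡ : IsCorner c lo hi
    c≡ 0F n = solve 1 (λ a → a := (a :+ (:- con 1ℚ)) :+ con 1ℚ) refl (seq (c 0F) n)
    c≡ 1F n = -‿involutive (seq (c 1F) n)
    c≡ 2F n = refl
    c≡ 3F n = -‿involutive (seq (c 3F) n)
    box : ∀ i → (∀ k → lo k ≤ point i k × point i k ≤ hi k) ⇔ (lift (point i) ∈S c)
    box i = box⇔simplex c lo hi c≡ (point i)
    -- The bounds are in the right order because the point `v` of `F` lies between them.
    lo≤hi : ∀ k → lo k ≤ hi k
    lo≤hi k =
      let (lo≤v , v≤hi) = from (box v) (to (F⇔S v) v∈F) k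
      in ≤-trans {lo k} {point v k} {hi k} lo≤v v≤hi

theorem31 : (P : FinitePointSet 2) (gp : GeneralPosition P) → IsTDDelaunay 4 (RD P gp)
theorem31 P gp =
  lifted P gp , (λ i → lift∈H (point i)) , lifted-gp P gp ,
  -- Relabelling along the identity rebuilds `F` by tabulation, which equals `F` only
  -- propositionally.
  ↔-id _ , λ F → subst (λ G → Face F ⇔ TDFace G) (sym (tabulate∘lookup F))
    (mk⇔ (rectangle⇒simplex P gp) (simplex⇒rectangle P gp))
  where
  open FinitePointSet P
  open SetSystem (RDSystem P) using (Face)
  open SetSystem (TDD (lifted P gp)) using () renaming (Face to TDFace)
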